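{- Let $A$ be a finite alphabet with $|A|\ge 2$. For every formula $\phi$ in the $\Sigma_2$ fragment of $\mathsf{FO}(A^*,\cdot)$ we can (effectively) construct a formula \[\psi=\exists x_1,\ldots,x_n.\ \forall y_1,\ldots,y_m.\ U\neq V,\] with $U,V\in (A\cup\{x_1,\ldots,x_n,y_1,\ldots,y_m\})^*$, such that $\phi$ holds in $A^*$ if and only if $\psi$ holds in $A^*$.
   Context: $A$ is an alphabet of constants (terminals), disjoint from the set of variables. A word equation is a formal equality $U=V$ where $U,V$ are words over constants and variables; a negated equation is $\lnot(U=V)$, also written $U\ne V$. Variables range over $A^*$; an assignment of words in $A^*$ to the variables is extended to a morphism fixing every letter of $A$, and it satisfies $U=V$ if the images of $U$ and $V$ coincide. A $\Sigma_2$ formula of $\mathsf{FO}(A^*,\cdot)$ is a sentence $\exists x_1,\ldots,x_n.\forall y_1,\ldots,y_\ell.\,\phi'$ with $\phi'$ a quantifier-free Boolean combination (using $\land,\lor,\lnot$) of word equations over $A\cup\{x_1,\ldots,x_n,y_1,\ldots,y_\ell\}$. The numbers and sets of variables in $\psi$ may differ from those in $\phi$. -}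

module Defs where

open import Data.Fin.Base using (Fin)
open import Data.List.Base using (List; [_]; concatMap)
open import Data.Nat.Base using (ℕ)
open import Data.Product.Base using (_×_; Σ-syntax)
open import Data.Sum.Base using (_⊎_; [_,_]′)
open import Level using (Level)
open import Relation.Binary.PropositionalEquality.Core using (_≡_)
open import Relation.Nullary.Negation.Core using (¬_)

private
  variable
    a x : Level

-- The disjoint sum keeps constants (A) and variables (X) disjoint.
Pattern : Set a → Set x → Set (a Level.⊔ x)
Pattern A X = List (A ⊎ X)

Assignment : Set a → Set x → Set (a Level.⊔ x)
Assignment A X = X → List A

-- The extension of an assignment to the monoid morphism (A ∪ X)* → A*
-- that fixes every letter of A.
_⟪_⟫ : {A : Set a} {X : Set x} → Assignment A X → Pattern A X → List A
σ ⟪ U ⟫ = concatMap [ [_] , σ ]′ U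

infix  7 _≐_ _≠_
infix  6 ∼_
infixr 5 _∧_
infixr 4 _∨_

data QuantifierFree (A : Set a) (X : Set x) : Set (a Level.⊔ x) where
  _≐_ : (U V : Pattern A X) → QuantifierFree A X
  ∼_  : QuantifierFree A X → QuantifierFree A X
  _∧_ : QuantifierFree A X → QuantifierFree A X → QuantifierFree A X
  _∨_ : QuantifierFree A X → QuantifierFree A X → QuantifierFree A X

_≠_ : {A : Set a} {X : Set x} → Pattern A X → Pattern A X → QuantifierFree A X
U ≠ V = ∼ (U ≐ V)

infix 3 _⊨_

-- Connectives are read as the constructive ones.  When A has decidable
-- equality (e.g. when A is finite) every σ ⊨ φ is decidable, so this is the
-- classical Boolean reading.
_⊨_ : {A : Set a} {X : Set x} → Assignment A X → QuantifierFree A X → Set a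
σ ⊨ (U ≐ V) = σ ⟪ U ⟫ ≡ σ ⟪ V ⟫
σ ⊨ (∼ φ)   = ¬ (σ ⊨ φ)
σ ⊨ (φ ∧ χ) = (σ ⊨ φ) × (σ ⊨ χ)
σ ⊨ (φ ∨ χ) = (σ ⊨ φ) ⊎ (σ ⊨ χ)

-- The n existentially and ℓ universally quantified variables are the left and
-- right summands of Fin n ⊎ Fin ℓ; every sentence is thereby closed.
Vars : ℕ → ℕ → Set
Vars n ℓ = Fin n ⊎ Fin ℓ

record Σ₂ (A : Set a) : Set a where
  constructor ∃∀
  field
    n ℓ    : ℕ
    matrix : QuantifierFree A (Vars n ℓ)

Holds : {A : Set a} → Σ₂ A → Set a
Holds {A = A} (∃∀ n ℓ φ) =
  Σ[ σ ∈ Assignment A (Fin n) ] ((τ : Assignment A (Fin ℓ)) → [ σ , τ ]′ ⊨ φ)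

{-# OPTIONS --safe #-}

-- Relations of the form ∃z. U = V are closed under conjunction, disjunction and
-- projection, and contain all inequations u ≠ v: either one word properly extends
-- the other, or they diverge at distinct letters after a common prefix. Hence the
-- negation of ∀y.φ′ is such a relation of the outer variables x, and ∀y.φ′ itself
-- is equivalent to ∀z. U ≠ V.
-- Conjunctions are merged by the injective pairing uavubv (a ≠ b letters).
-- For a disjunction, "u = v" is replaced by the always solvable bubp = qbvb, which
-- gives u = v back once p and q are powers of a; the equation de = a decides on
-- which of the two sides this is enforced.
module Submission where

open import Defs
open import Data.Empty using (⊥)
open import Data.Fin.Base using (Fin; zero; suc; join; splitAt)
open import Data.Fin.Patterns using (0F; 1F; 2F; 3F; 4F; 5F)
open import Data.Fin.Properties using (splitAt-join; inj⇒≟)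
open import Data.List.Base as List using (List; []; _∷_; _++_; map; length)
open import Data.List.Properties
  using (≡-dec; ∷-injective; ∷-injectiveˡ; ∷-injectiveʳ; ++-identityʳ;
         ++-cancelˡ; length-++; concatMap-cong; concatMap-map; concatMap-++)
open import Data.List.Relation.Unary.All as All using (All; []; _∷_)
open import Data.List.Relation.Unary.All.Properties using (++⁻; ++⁻ʳ)
open import Data.Nat.Base using (ℕ; zero; suc; _≤_; _+_; ⌊_/2⌋; s≤s; z≤n)
open import Data.Nat.Properties using (n≡⌊n+n/2⌋; suc-injective)
open import Data.Product.Base using (Σ-syntax; ∃-syntax; _×_; _,_)
open import Data.Sum.Base as Sum using (_⊎_; inj₁; inj₂; [_,_]; [_,_]′; map₁; map₂)
open import Data.Vec.Base using (lookup; _∷_; [])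
open import Function.Base using (_∘_; _$_)
open import Function.Bundles using (_↔_; _⇔_; mk⇔; Equivalence; Injection; Inverse)
open import Function.Properties.Inverse using (↔⇒↣; ↔-sym)
open import Level using (Level)
open import Relation.Binary.Definitions using (DecidableEquality)
open import Relation.Binary.PropositionalEquality
  using (_≡_; _≢_; _≗_; refl; sym; trans; cong; cong₂; subst; subst₂)
open import Relation.Nullary using (¬_; Dec; yes; no; contradiction)
open import Relation.Nullary.Decidable using (¬?; _×-dec_; _⊎-dec_; decidable-stable)

open Equivalence using (to; from)

private
  variable
    ℓ r s : Level
    A : Set ℓ
    X Y : Set

-- Combinatorics on words

++-injective : (us vs : List A) {us′ vs′ : List A} → length us ≡ length vs →
               us ++ us′ ≡ vs ++ vs′ → us ≡ vs × us′ ≡ vs′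
++-injective []       []       _ eq = refl , eq
++-injective (u ∷ us) (v ∷ vs) l eq
  with ++-injective us vs (suc-injective l) (∷-injectiveʳ eq)
... | refl , eq′ = cong (_∷ us) (∷-injectiveˡ eq) , eq′

module _ {a b : A} (a≢b : a ≢ b) where

  pair : List A → List A → List A
  pair u v = (u ++ a ∷ v) ++ (u ++ b ∷ v)

  -- If `u` and `u′` had different lengths, the longer would have one letter at the place of the
  -- other's separator, equal to `a` by one equation and to `b` by the other.
  separators-injective : ∀ u u′ {v v′} → u ++ a ∷ v ≡ u′ ++ a ∷ v′ →
                         u ++ b ∷ v ≡ u′ ++ b ∷ v′ → u ≡ u′ × v ≡ v′
  separators-injective []      []       eq eq′ = refl , ∷-injectiveʳ eq
  separators-injective []      (_ ∷ _)  eq eq′ =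
    contradiction (trans (∷-injectiveˡ eq) (sym (∷-injectiveˡ eq′))) a≢b
  separators-injective (_ ∷ _) []       eq eq′ =
    contradiction (trans (sym (∷-injectiveˡ eq)) (∷-injectiveˡ eq′)) a≢b
  separators-injective (x ∷ u) (_ ∷ u′) eq eq′
    with ∷-injective eq | separators-injective u u′ (∷-injectiveʳ eq) (∷-injectiveʳ eq′)
  ... | refl , _ | refl , v≡v′ = refl , v≡v′

  length-pair : ∀ u v → length (pair u v) ≡ length (u ++ a ∷ v) + length (u ++ a ∷ v)
  length-pair u v = trans (length-++ (u ++ a ∷ v))
    (cong (length (u ++ a ∷ v) +_) (trans (length-++ u) (sym (length-++ u))))

  -- The two halves of a pair have equal length, so the length of the whole fixes the midpoint and
  -- the equation splits there.
  pair-injective : ∀ u v u′ v′ → pair u v ≡ pair u′ v′ → u ≡ u′ × v ≡ v′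
  pair-injective u v u′ v′ eq =
    let eqᵃ , eqᵇ = ++-injective (u ++ a ∷ v) (u′ ++ a ∷ v′) halves eq
    in separators-injective u u′ eqᵃ eqᵇ
    where
    halves : length (u ++ a ∷ v) ≡ length (u′ ++ a ∷ v′)
    halves = trans (n≡⌊n+n/2⌋ _) $
      trans (cong ⌊_/2⌋ (trans (sym (length-pair u v)) (trans (cong length eq) (length-pair u′ v′)))) $
      sym (n≡⌊n+n/2⌋ _)

  -- The equation identifies each letter of `w` with the one before it, starting from `a`.
  commutes⇒power : ∀ w → w ++ List.[ a ] ≡ a ∷ w → All (_≡ a) w
  commutes⇒power []      _  = []
  commutes⇒power (x ∷ w) eq with ∷-injective eq
  ... | refl , eq′ = refl ∷ commutes⇒power w eq′

  -- The last `b` stands just before `p` on the left and at the very end on the right, which forces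
  -- `p` to be empty.
  trailing-power : ∀ u v {p} → All (_≡ a) p → u ++ b ∷ p ≡ v ++ List.[ b ] → u ≡ v
  trailing-power []      []      _  _  = refl
  trailing-power []      (_ ∷ v) ps eq =
    contradiction (sym (All.head (++⁻ʳ v (subst (All (_≡ a)) (∷-injectiveʳ eq) ps)))) a≢b
  trailing-power (_ ∷ []) []    _  ()
  trailing-power (_ ∷ _ ∷ _) [] _  ()
  trailing-power (_ ∷ u) (_ ∷ v) ps eq =
    cong₂ _∷_ (∷-injectiveˡ eq) (trailing-power u v ps (∷-injectiveʳ eq))

  -- Solved by p = vb, q = bu for all u and v, and among powers of a only by p = q = ε.
  padded : List A → List A → List A → List A → Set _
  padded u v p q = b ∷ u ++ b ∷ p ≡ q ++ b ∷ v ++ List.[ b ]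

  padded-power : ∀ u v {p q} → All (_≡ a) (p ++ q) → padded u v p q → u ≡ v
  padded-power u v {p} {q} pqs eq with ++⁻ p pqs
  padded-power u v {q = []}    _ eq | ps , _         = trailing-power u v ps (∷-injectiveʳ eq)
  -- A nonempty `q` would begin with `a`, but the left side begins with `b`.
  padded-power u v {q = _ ∷ _} _ eq | _ , refl ∷ _ =
    contradiction (sym (∷-injectiveˡ eq)) a≢b

  padded-refl : ∀ {u v} → u ≡ v → padded u v [] []
  padded-refl refl = refl

  -- Exactly one of d and e is the letter a, and that one forces its pair to be powers of a.
  switch : (u v u′ v′ p q p′ q′ d e : List A) → Set _
  switch u v u′ v′ p q p′ q′ d e =
    d ++ e ≡ List.[ a ] ×
    (padded u  v  p  q  × (p  ++ q ) ++ d ≡ d ++ (p  ++ q )) ×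
    (padded u′ v′ p′ q′ × (p′ ++ q′) ++ e ≡ e ++ (p′ ++ q′))

  switch-sound : ∀ {u v u′ v′ p q p′ q′} d {e} →
                 switch u v u′ v′ p q p′ q′ d e → u ≡ v ⊎ u′ ≡ v′
  -- An empty `d` makes `e` the letter `a`, so the primed pair is the one forced to consist of
  -- powers of `a`.
  switch-sound []          (refl , _ , eq , comm) = inj₂ (padded-power _ _ (commutes⇒power _ comm) eq)
  switch-sound (_ ∷ [])    (refl , (eq , comm) , _) = inj₁ (padded-power _ _ (commutes⇒power _ comm) eq)
  switch-sound (_ ∷ _ ∷ _) (() , _)

-- Positive characterisation of distinct words

module _ {A : Set ℓ} where

  -- The explicit letter `c` makes the extension proper; over a finite alphabet its quantifier
  -- becomes a disjunction.
  Extends : List A → List A → Set ℓ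
  Extends u v = ∃[ c ] ∃[ s ] u ≡ v ++ c ∷ s

  Diverge : List A → List A → A → A → Set ℓ
  Diverge u v c d = ∃[ w ] ∃[ s ] ∃[ t ] u ≡ w ++ c ∷ s × v ≡ w ++ d ∷ t

  Differ : List A → List A → Set ℓ
  Differ u v = (Extends u v ⊎ Extends v u) ⊎ (∃[ c ] ∃[ d ] c ≢ d × Diverge u v c d)

  differ-∷ : ∀ {x u v} → Differ u v → Differ (x ∷ u) (x ∷ v)
  differ-∷ (inj₁ (inj₁ (c , s , eq))) = inj₁ (inj₁ (c , s , cong (_ ∷_) eq))
  differ-∷ (inj₁ (inj₂ (c , s , eq))) = inj₁ (inj₂ (c , s , cong (_ ∷_) eq))
  differ-∷ (inj₂ (c , d , c≢d , w , s , t , eq , eq′)) =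
    inj₂ (c , d , c≢d , _ ∷ w , s , t , cong (_ ∷_) eq , cong (_ ∷_) eq′)

  ≢⇒differ : DecidableEquality A → ∀ u v → u ≢ v → Differ u v
  ≢⇒differ _≟_ []      []      u≢v = contradiction refl u≢v
  ≢⇒differ _≟_ []      (y ∷ v) _   = inj₁ (inj₂ (y , v , refl))
  ≢⇒differ _≟_ (x ∷ u) []      _   = inj₁ (inj₁ (x , u , refl))
  ≢⇒differ _≟_ (x ∷ u) (y ∷ v) u≢v with x ≟ y
  ... | yes refl = differ-∷ (≢⇒differ _≟_ u v (u≢v ∘ cong (x ∷_)))
  ... | no x≢y   = inj₂ (x , y , x≢y , [] , u , v , refl , refl)

  ¬extends-self : ∀ u → ¬ Extends u u
  ¬extends-self u (c , s , eq) with () ← ++-cancelˡ u [] (c ∷ s) (trans (++-identityʳ u) eq)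

  differ⇒≢ : ∀ {u v} → Differ u v → u ≢ v
  differ⇒≢ (inj₁ (inj₁ e)) refl = ¬extends-self _ e
  differ⇒≢ (inj₁ (inj₂ e)) refl = ¬extends-self _ e
  differ⇒≢ (inj₂ (c , d , c≢d , w , s , t , eq , eq′)) refl =
    c≢d (∷-injectiveˡ (++-cancelˡ w (c ∷ s) (d ∷ t) (trans (sym eq) eq′)))

-- Word functions given by patterns

⟪⟫-cong : {σ τ : Assignment A X} → σ ≗ τ → ∀ U → σ ⟪ U ⟫ ≡ τ ⟪ U ⟫
⟪⟫-cong σ≗τ = concatMap-cong [ (λ _ → refl) , σ≗τ ]

⟪⟫-rename : (σ : Assignment A Y) (ρ : X → Y) (U : Pattern A X) →
            σ ⟪ map (map₂ ρ) U ⟫ ≡ (σ ∘ ρ) ⟪ U ⟫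
⟪⟫-rename σ ρ U = trans (concatMap-map _ (map₂ ρ) U)
  (concatMap-cong [ (λ _ → refl) , (λ _ → refl) ] U)

module _ {A : Set ℓ} where

  -- Pairs a pattern with its meaning, so that relations can be stated through `f σ`, free of the
  -- trailing `++ []` that `concatMap` leaves behind.
  Expressible : (Assignment A X → List A) → Set ℓ
  Expressible {X = X} f = Σ[ U ∈ Pattern A X ] (∀ σ → σ ⟪ U ⟫ ≡ f σ)

  pattern-⟪_⟫ : (U : Pattern A X) → Expressible (_⟪ U ⟫)
  pattern-⟪ U ⟫ = U , λ _ → refl

  ε : Expressible {X = X} (λ _ → [])
  ε = [] , λ _ → refl

  letter : (c : A) → Expressible {X = X} (λ _ → List.[ c ])
  letter c = List.[ inj₁ c ] , λ _ → refl

  var : (x : X) → Expressible (λ σ → σ x)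
  var x = List.[ inj₂ x ] , λ σ → ++-identityʳ (σ x)

  infixr 5 _·_

  _·_ : {f g : Assignment A X → List A} →
        Expressible f → Expressible g → Expressible (λ σ → f σ ++ g σ)
  (U , U≡f) · (V , V≡g) = U ++ V , λ σ → trans (concatMap-++ _ U V) (cong₂ _++_ (U≡f σ) (V≡g σ))

  substitute : (ρ : X → Y) {θ : Assignment A Y → Assignment A X} → (∀ σ → σ ∘ ρ ≗ θ σ) →
               (U : Pattern A X) → Expressible (λ σ → θ σ ⟪ U ⟫)
  substitute ρ ρ≗θ U =
    map (map₂ ρ) U , λ σ → trans (⟪⟫-rename σ ρ U) (⟪⟫-cong (ρ≗θ σ) U)

  weaken : {f : Assignment A X → List A} → Expressible f →
           Expressible {X = X ⊎ Y} (λ σ → f (σ ∘ inj₁))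
  weaken (U , U≡f) = map (map₂ inj₁) U , λ σ → trans (⟪⟫-rename σ inj₁ U) (U≡f _)

  ⊨-dec : DecidableEquality A → (σ : Assignment A X) (φ : QuantifierFree A X) → Dec (σ ⊨ φ)
  ⊨-dec _≟_ σ (U ≐ V) = ≡-dec _≟_ _ _
  ⊨-dec _≟_ σ (∼ φ)   = ¬? (⊨-dec _≟_ σ φ)
  ⊨-dec _≟_ σ (φ ∧ χ) = ⊨-dec _≟_ σ φ ×-dec ⊨-dec _≟_ σ χ
  ⊨-dec _≟_ σ (φ ∨ χ) = ⊨-dec _≟_ σ φ ⊎-dec ⊨-dec _≟_ σ χ

-- Relations of the form ∃z. U = V

  record Definable (R : Assignment A X → Set r) : Set (ℓ Level.⊔ r) where
    constructor ∃[_]_≐_by_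
    field
      arity   : ℕ
      lhs rhs : Pattern A (X ⊎ Fin arity)
      defines : ∀ σ → R σ ⇔
                (Σ[ τ ∈ Assignment A (Fin arity) ] [ σ , τ ]′ ⟪ lhs ⟫ ≡ [ σ , τ ]′ ⟪ rhs ⟫)

  private
    variable
      R : Assignment A X → Set r
      S : Assignment A X → Set s
      f g h k : Assignment A X → List A

  definable-resp-⇔ : Definable R → (∀ σ → R σ ⇔ S σ) → Definable S
  definable-resp-⇔ (∃[ m ] U ≐ V by def) R⇔S = ∃[ m ] U ≐ V by λ σ →
    mk⇔ (to (def σ) ∘ from (R⇔S σ)) (to (R⇔S σ) ∘ from (def σ))

  definable-≡ : Expressible f → Expressible g → Definable (λ σ → f σ ≡ g σ)
  definable-≡ F G with weaken {Y = Fin 0} F | weaken {Y = Fin 0} G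
  ... | U , U≡f | V , V≡g = ∃[ 0 ] U ≐ V by λ σ → mk⇔
    (λ f≡g → (λ ()) , trans (U≡f _) (trans f≡g (sym (V≡g _))))
    (λ (_ , U≡V) → trans (sym (U≡f _)) (trans U≡V (V≡g _)))

  -- The quantified variables and the old witnesses are merged by `ρ` into one block of `n + m`
  -- witnesses. Assignments are compared only pointwise, which suffices for evaluating patterns.
  definable-∃ : ∀ {n} {R : Assignment A (X ⊎ Fin n) → Set r} → Definable R →
                Definable (λ σ → Σ[ τ ∈ Assignment A (Fin n) ] R [ σ , τ ]′)
  definable-∃ {X = X} {n = n} (∃[ m ] U ≐ V by def) =
    ∃[ n + m ] map (map₂ ρ) U ≐ map (map₂ ρ) V by λ σ → mk⇔
      (λ (τ , Rτ) → let τ′ , eq = to (def _) Rτ in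
        [ τ , τ′ ]′ ∘ splitAt n , transport (sym ∘ rejoin σ τ τ′) eq)
      (λ (τ , eq) → τ ∘ join n m ∘ inj₁ , from (def _) (τ ∘ join n m ∘ inj₂ , transport (split σ τ) eq))
    where
    ρ : (X ⊎ Fin n) ⊎ Fin m → X ⊎ Fin (n + m)
    ρ = [ map₂ (join n m ∘ inj₁) , inj₂ ∘ join n m ∘ inj₂ ]′

    split : ∀ σ τ W → [ σ , τ ]′ ⟪ map (map₂ ρ) W ⟫ ≡
            [ [ σ , τ ∘ join n m ∘ inj₁ ]′ , τ ∘ join n m ∘ inj₂ ]′ ⟪ W ⟫
    split σ τ W = trans (⟪⟫-rename [ σ , τ ]′ ρ W)
      (⟪⟫-cong [ [ (λ _ → refl) , (λ _ → refl) ] , (λ _ → refl) ] W)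

    rejoin : ∀ σ τ τ′ W → [ σ , [ τ , τ′ ]′ ∘ splitAt n ]′ ⟪ map (map₂ ρ) W ⟫ ≡
             [ [ σ , τ ]′ , τ′ ]′ ⟪ W ⟫
    rejoin σ τ τ′ W = trans (⟪⟫-rename _ ρ W) (⟪⟫-cong
      [ [ (λ _ → refl) , cong [ τ , τ′ ]′ ∘ splitAt-join n m ∘ inj₁ ]
      , cong [ τ , τ′ ]′ ∘ splitAt-join n m ∘ inj₂ ] W)

    transport : {κ κ′ : Pattern A ((X ⊎ Fin n) ⊎ Fin m) → List A} → κ ≗ κ′ → κ U ≡ κ V → κ′ U ≡ κ′ V
    transport κ≗κ′ = subst₂ _≡_ (κ≗κ′ U) (κ≗κ′ V)

  -- A connective that preserves definability of equations preserves
  -- definability of relations, the two sets of witnesses being kept apart.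
  definable-∃∃ :
    (_∙_ : Set ℓ → Set ℓ → Set ℓ) →
    (∀ {X} {f g h k : Assignment A X → List A} →
       Expressible f → Expressible g → Expressible h → Expressible k →
       Definable (λ σ → (f σ ≡ g σ) ∙ (h σ ≡ k σ))) →
    ∀ {m n} (U V : Pattern A (X ⊎ Fin m)) (U′ V′ : Pattern A (X ⊎ Fin n)) →
    Definable (λ σ → Σ[ τ ∈ Assignment A (Fin m) ] Σ[ τ′ ∈ Assignment A (Fin n) ]
      (([ σ , τ ]′ ⟪ U ⟫ ≡ [ σ , τ ]′ ⟪ V ⟫) ∙ ([ σ , τ′ ]′ ⟪ U′ ⟫ ≡ [ σ , τ′ ]′ ⟪ V′ ⟫)))
  definable-∃∃ _∙_ equations U V U′ V′ = definable-∃ (definable-∃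
    (equations (weaken pattern-⟪ U ⟫) (weaken pattern-⟪ V ⟫) (skip U′) (skip V′)))
    where
    skip : ∀ {X Y Z : Set} (W : Pattern A (X ⊎ Z)) →
           Expressible {X = (X ⊎ Y) ⊎ Z} (λ σ → [ σ ∘ inj₁ ∘ inj₁ , σ ∘ inj₂ ]′ ⟪ W ⟫)
    skip = substitute (map₁ inj₁) (λ _ → [ (λ _ → refl) , (λ _ → refl) ])

  -- Closure under conjunction and disjunction

  module _ {a b : A} (a≢b : a ≢ b) where

    definable-≡×≡ : Expressible f → Expressible g → Expressible h → Expressible k →
                    Definable (λ σ → f σ ≡ g σ × h σ ≡ k σ)
    definable-≡×≡ F G H K = definable-resp-⇔
      (definable-≡ ((F · letter a · H) · (F · letter b · H)) ((G · letter a · K) · (G · letter b · K)))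
      (λ _ → mk⇔ (pair-injective a≢b _ _ _ _) (λ (f≡g , h≡k) → cong₂ (pair a≢b) f≡g h≡k))

    definable-× : {R S : Assignment A X → Set ℓ} →
                  Definable R → Definable S → Definable (λ σ → R σ × S σ)
    definable-× (∃[ m ] U ≐ V by def) (∃[ n ] U′ ≐ V′ by def′) = definable-resp-⇔
      (definable-∃∃ _×_ definable-≡×≡ U V U′ V′)
      (λ σ → mk⇔
        (λ (τ , τ′ , eq , eq′) → from (def σ) (τ , eq) , from (def′ σ) (τ′ , eq′))
        (λ (Rσ , Sσ) → let τ , eq = to (def σ) Rσ ; τ′ , eq′ = to (def′ σ) Sσ in τ , τ′ , eq , eq′))

    definable-padded : Expressible f → Expressible g → Expressible h → Expressible k →
                       Definable (λ σ → padded a≢b (f σ) (g σ) (h σ) (k σ))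
    definable-padded F G P Q =
      definable-≡ (letter b · F · letter b · P) (Q · letter b · G · letter b)

    definable-≡⊎≡ : Expressible f → Expressible g → Expressible h → Expressible k →
                    Definable (λ σ → f σ ≡ g σ ⊎ h σ ≡ k σ)
    definable-≡⊎≡ {X} {f} {g} {h} {k} F G H K = definable-resp-⇔
      -- The six witnesses are `p`, `q`, `p′`, `q′`, `d`, `e` of `switch`, in this order.
      (definable-∃ {n = 6} (definable-×
        (definable-≡ (z 4F · z 5F) (letter a))
        (definable-×
          (definable-× (definable-padded (weaken F) (weaken G) (z 0F) (z 1F))
                       (definable-≡ ((z 0F · z 1F) · z 4F) (z 4F · (z 0F · z 1F))))
          (definable-× (definable-padded (weaken H) (weaken K) (z 2F) (z 3F))
                       (definable-≡ ((z 2F · z 3F) · z 5F) (z 5F · (z 2F · z 3F)))))))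
      (λ σ → mk⇔
        (λ (τ , sw) → switch-sound a≢b (τ 4F) sw)
        -- The true equation takes the switch letter `a` and empty padding; the other, unenforced,
        -- takes the solution that exists for any two words.
        [ (λ f≡g → lookup ([] ∷ [] ∷ (k σ ++ List.[ b ]) ∷ (b ∷ h σ) ∷ List.[ a ] ∷ [] ∷ []) ,
             refl , (padded-refl a≢b f≡g , refl) , refl , ++-identityʳ _)
        , (λ h≡k → lookup ((g σ ++ List.[ b ]) ∷ (b ∷ f σ) ∷ [] ∷ [] ∷ [] ∷ List.[ a ] ∷ []) ,
             refl , (refl , ++-identityʳ _) , padded-refl a≢b h≡k , refl) ])
      where
      z : (i : Fin 6) → Expressible {X = X ⊎ Fin 6} (λ σ → σ (inj₂ i))
      z i = var (inj₂ i)

    definable-⊎ : {R S : Assignment A X → Set ℓ} →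
                  Definable R → Definable S → Definable (λ σ → R σ ⊎ S σ)
    definable-⊎ (∃[ m ] U ≐ V by def) (∃[ n ] U′ ≐ V′ by def′) = definable-resp-⇔
      (definable-∃∃ _⊎_ definable-≡⊎≡ U V U′ V′)
      (λ σ → mk⇔
        (λ (τ , τ′ , eqs) → Sum.map (λ eq → from (def σ) (τ , eq)) (λ eq → from (def′ σ) (τ′ , eq)) eqs)
        -- Both blocks of witnesses are quantified outside the disjunction, so the side not chosen
        -- still needs values; empty words serve.
        [ (λ Rσ → let τ , eq = to (def σ) Rσ in τ , (λ _ → []) , inj₁ eq)
        , (λ Sσ → let τ , eq = to (def′ σ) Sσ in (λ _ → []) , τ , inj₂ eq) ])

    -- Absorbs conditions independent of the variables, such as `c ≢ d` for fixed letters or the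
    -- empty disjunction, as a valid or an unsolvable equation.
    definable-Dec : {P : Set r} → Dec P → Definable {X = X} (λ _ → P)
    definable-Dec (yes p) = definable-resp-⇔ (definable-≡ ε ε) (λ _ → mk⇔ (λ _ → p) (λ _ → refl))
    definable-Dec (no ¬p) = definable-resp-⇔ (definable-≡ (letter a) ε)
      (λ _ → mk⇔ (λ ()) (λ p → contradiction p ¬p))

    definable-∃Fin : ∀ {n} {R : Fin n → Assignment A X → Set ℓ} →
                     (∀ i → Definable (R i)) → Definable (λ σ → ∃[ i ] R i σ)
    definable-∃Fin {n = zero}  _ = definable-resp-⇔
      (definable-Dec {P = ⊥} (no λ ())) (λ _ → mk⇔ (λ ()) λ ())
    definable-∃Fin {n = suc n} D = definable-resp-⇔
      (definable-⊎ (D zero) (definable-∃Fin (D ∘ suc)))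
      (λ _ → mk⇔ [ (zero ,_) , (λ (i , Rσ) → suc i , Rσ) ]
        λ { (zero , Rσ) → inj₁ Rσ ; (suc i , Rσ) → inj₂ (i , Rσ) })

    -- Inequations and formulas over a finite alphabet

    module _ {n} (A↔Fin : A ↔ Fin n) where

      infix 4 _≟_

      _≟_ : DecidableEquality A
      _≟_ = inj⇒≟ (↔⇒↣ A↔Fin)

      -- Witness variables range over words, so a letter is quantified by a disjunction over the
      -- finite alphabet instead.
      definable-∃letter : {R : A → Assignment A X → Set ℓ} →
                          (∀ c → Definable (R c)) → Definable (λ σ → ∃[ c ] R c σ)
      definable-∃letter {R = R} D = definable-resp-⇔
        (definable-∃Fin (D ∘ Inverse.from A↔Fin))
        (λ σ → mk⇔ (λ (i , Rσ) → Inverse.from A↔Fin i , Rσ)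
          (λ (c , Rσ) → Inverse.to A↔Fin c ,
            subst (λ c → R c σ) (sym (Inverse.strictlyInverseʳ A↔Fin c)) Rσ))

      definable-extends : Expressible f → Expressible g → Definable (λ σ → Extends (f σ) (g σ))
      definable-extends F G = definable-∃letter λ c → definable-resp-⇔
        (definable-∃ {n = 1} (definable-≡ (weaken F) (weaken G · letter c · var (inj₂ 0F))))
        (λ _ → mk⇔ (λ (τ , eq) → τ 0F , eq) (λ (s , eq) → (λ _ → s) , eq))

      definable-diverge : Expressible f → Expressible g → ∀ c d →
                          Definable (λ σ → Diverge (f σ) (g σ) c d)
      definable-diverge F G c d = definable-resp-⇔
        (definable-∃ {n = 3} (definable-≡×≡
          (weaken F) (var (inj₂ 0F) · letter c · var (inj₂ 1F))
          (weaken G) (var (inj₂ 0F) · letter d · var (inj₂ 2F))))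
        (λ _ → mk⇔ (λ (τ , eqs) → τ 0F , τ 1F , τ 2F , eqs)
          (λ (w , s , t , eqs) → lookup (w ∷ s ∷ t ∷ []) , eqs))

      definable-≢ : Expressible f → Expressible g → Definable (λ σ → f σ ≢ g σ)
      definable-≢ F G = definable-resp-⇔
        (definable-⊎ (definable-⊎ (definable-extends F G) (definable-extends G F))
          (definable-∃letter λ c → definable-∃letter λ d →
            definable-× (definable-Dec (¬? (c ≟ d))) (definable-diverge F G c d)))
        (λ _ → mk⇔ differ⇒≢ (≢⇒differ _≟_ _ _))

      -- Closure under complement is not at hand, so truth and falsity are treated by mutual
      -- recursion: negations move inward until they meet equations, where `definable-≢` takes over.
      definable-⊨ : (φ : QuantifierFree A X) → Definable (_⊨ φ)
      definable-⊭ : (φ : QuantifierFree A X) → Definable (λ σ → ¬ (σ ⊨ φ))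

      definable-⊨ (U ≐ V) = definable-≡ pattern-⟪ U ⟫ pattern-⟪ V ⟫
      definable-⊨ (∼ φ)   = definable-⊭ φ
      definable-⊨ (φ ∧ χ) = definable-× (definable-⊨ φ) (definable-⊨ χ)
      definable-⊨ (φ ∨ χ) = definable-⊎ (definable-⊨ φ) (definable-⊨ χ)

      definable-⊭ (U ≐ V) = definable-≢ pattern-⟪ U ⟫ pattern-⟪ V ⟫
      definable-⊭ (∼ φ)   = definable-resp-⇔
        (definable-⊨ φ) (λ σ → mk⇔ (λ p ¬p → ¬p p) (decidable-stable (⊨-dec _≟_ σ φ)))
      definable-⊭ (φ ∧ χ) = definable-resp-⇔
        (definable-⊎ (definable-⊭ φ) (definable-⊭ χ))
        -- This De Morgan law is not constructive in general; deciding the first conjunct tells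
        -- which one fails.
        (λ σ → mk⇔ [ (λ ¬p (p , _) → ¬p p) , (λ ¬q (_ , q) → ¬q q) ] (deMorgan (⊨-dec _≟_ σ φ)))
        where
        deMorgan : {P : Set r} {Q : Set s} → Dec P → ¬ (P × Q) → ¬ P ⊎ ¬ Q
        deMorgan (yes p) ¬pq = inj₂ λ q → ¬pq (p , q)
        deMorgan (no ¬p) _   = inj₁ ¬p
      definable-⊭ (φ ∨ χ) = definable-resp-⇔
        (definable-× (definable-⊭ φ) (definable-⊭ χ))
        (λ σ → mk⇔ (λ (¬p , ¬q) → [ ¬p , ¬q ]) (λ ¬pq → ¬pq ∘ inj₁ , ¬pq ∘ inj₂))

-- Supplies the two letters on which pairing and padding rest.
first-two-distinct : ∀ {n} (A↔Fin : A ↔ Fin (suc (suc n))) →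
                     Inverse.from A↔Fin 0F ≢ Inverse.from A↔Fin 1F
first-two-distinct A↔Fin eq with () ← Injection.injective (↔⇒↣ (↔-sym A↔Fin)) eq

theorem3p5 : ∀ {a} {A : Set a} {k : ℕ} → A ↔ Fin k → 2 ≤ k → (φ : Σ₂ A) →
    ∃[ n ] ∃[ m ] Σ[ U ∈ Pattern A (Vars n m) ] Σ[ V ∈ Pattern A (Vars n m) ]
    (Holds φ ⇔ Holds (∃∀ n m (U ≠ V)))
theorem3p5 A↔Fin (s≤s (s≤s z≤n)) (∃∀ n ℓ φ)
  -- The block projected away is that of the universal variables, so the `n` existential ones stay
  -- free and keep their values in both directions below.
  with definable-∃ (definable-⊭ (first-two-distinct A↔Fin) A↔Fin φ)
... | ∃[ m ] U ≐ V by def = n , m , U , V , mk⇔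
  (λ (σ , holds) → σ , λ τ U≡V → let τ′ , ¬φ = from (def σ) (τ , U≡V) in ¬φ (holds τ′))
  -- A counterexample to `φ` would solve `U ≐ V`; this refutes only the failure of `φ`, and
  -- decidability then yields `φ` itself.
  (λ (σ , U≢V) → σ , λ τ → decidable-stable (⊨-dec (inj⇒≟ (↔⇒↣ A↔Fin)) _ φ)
    λ ¬φ → let τ′ , U≡V = to (def σ) (τ , ¬φ) in U≢V τ′ U≡V)
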